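{- Each of the following families of games is pet and returnable but not forced: Pawn on the set of all nonempty partitions; Knight on the set of all rectangles; King on the set of all staircases; Pawn on the set of all staircases; Downright on the set of all nonempty subpartitions of generalized staircases.
   Context: A partition is a finite weakly decreasing sequence $\lambda=[\lambda_1,\ldots,\lambda_r]$ of positive integers; $[\,]$ is the empty partition, and $\mathbb Y^+$ is the set of nonempty partitions. For $i,j\ge 0$, $\lambda[i,j]=[\lambda_{i+1}-j,\lambda_{i+2}-j,\ldots]$ with trailing nonpositive entries removed. For a moveset $M\subseteq \mathbb Z_{\ge0}^2\setminus\{(0,0)\}$ and $\lambda\in\mathbb Y^+$, the impartial chess game $(M,\lambda)$ starts at $\lambda$, and from a position $\mu\in\mathbb Y^+$ a player may move to $\mu[i,j]$ for any $(i,j)\in M$ with $\mu[i,j]\ne[\,]$. The positions of $(M,\lambda)$ are the partitions reachable from $\lambda$ by zero or more moves. A position is terminal if it has no moves. Movesets: Downright $\{(0,1),(1,0)\}$; Pawn $\{(0,1),(1,1)\}$; Knight $\{(1,2),(2,1)\}$; King $\{(0,1),(1,0),(1,1)\}$. Rectangles are the partitions $[c^r]$ ($c$ repeated $r$ times), $r,c\ge1$; staircases are the partitions $[k,k-1,\ldots,1]$, $k\ge1$; the generalized staircase with parameters $r,c,k\ge1$ is $[(kc)^r,((k-1)c)^r,\ldots,c^r]$ (exponents denote repetition). A nonempty subpartition of a generalized staircase $\lambda$ is a partition $\lambda[i,j]\neq[\,]$ with $i,j\ge0$. The Sprague-Grundy value of a position $p$ is $\mathrm{mex}$ of the Sprague-Grundy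 values of the positions reachable in one move ($0$ if $p$ is terminal), where $\mathrm{mex}(S)$ is the least nonnegative integer not in $S$. The misère Grundy value is defined by the same mex recursion at non-terminal positions, but terminal positions have value $1$. A position with Sprague-Grundy value $t$ and misère Grundy value $\ell$ is called a $(t,\ell)$-position. A game is returnable if for any move from a $(0,1)$-position (resp. a $(1,0)$-position) to a non-terminal position $y$, there is a move from $y$ to a $(0,1)$-position (resp. to a $(1,0)$-position). A game is forced if each move from a $(0,1)$-position results in a $(1,0)$-position and each move from a $(1,0)$-position results in a $(0,1)$-position. A game is pet if it has only $(0,1)$-positions, $(1,0)$-positions, and $(k,k)$-positions with $k\ge2$. For a moveset $M$ and a set $P\subseteq\mathbb Y^+$, the family $(M,P)$ has one of these properties if $(M,\lambda)$ has it for every $\lambda\in P$, and it does not have the property if $(M,\lambda)$ fails it for at least one $\lambda\in P$. -}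

module Defs where

open import Data.Empty using (⊥-elim)
open import Data.List.Base
  using (List; []; _∷_; map; filter; drop; replicate; concatMap; applyDownFrom)
open import Data.List.Membership.DecPropositional using (_∈?_)
open import Data.List.Membership.Propositional using (_∈_; _∉_; mapWith∈)
open import Data.List.Membership.Propositional.Properties
  using (∈-filter⁺; ∈-filter⁻; ∈-map⁺; ∈-map⁻; mapWith∈-cong; mapWith∈≗map)
open import Data.List.Relation.Unary.All using (All)
open import Data.List.Relation.Unary.All.Properties using (all-filter)
open import Data.List.Relation.Unary.Any using (here; there)
open import Data.List.Relation.Unary.Linked using (Linked; []; [-]; _∷_)
import Data.List.Relation.Unary.Linked as Linked
import Data.List.Relation.Unary.Linked.Properties as Linkedₚ
open import Data.Nat.Base
open import Data.Nat.Induction using (<-wellFounded)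
open import Data.Nat.ListAction using (sum)
open import Data.Nat.Properties
open import Data.Product.Base using (_×_; _,_; ∃-syntax)
open import Data.Sum.Base using (_⊎_; inj₁; inj₂)
open import Function.Base using (_on_; _∘_)
open import Induction.WellFounded using (WellFounded; WfRec; module All; module FixPoint)
open import Level using (0ℓ)
open import Relation.Binary.Construct.Closure.ReflexiveTransitive using (Star)
import Relation.Binary.Construct.On as On
open import Relation.Binary.PropositionalEquality
  using (_≡_; _≢_; refl; sym; trans; cong; subst)
open import Relation.Nullary using (¬_; yes; no)
open import Relation.Unary using (Pred; Decidable)

-- The invariants are irrelevant, so two partitions with the same parts are
-- definitionally equal.
record Partition : Set where
  constructor mkPartition
  field
    parts       : List ℕ
    .decreasing : Linked _≥_ parts
    .positive   : All (0 <_) parts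

open Partition public using (parts)

Nonempty : Pred Partition 0ℓ
Nonempty μ = parts μ ≢ []

nonempty? : Decidable Nonempty
nonempty? (mkPartition []      _ _) = no λ []≢[] → []≢[] refl
nonempty? (mkPartition (_ ∷ _) _ _) = yes λ ()

-- Parts that become nonpositive are truncated to 0 by _∸_; on a weakly
-- decreasing list the zeros are exactly a trailing segment.
shift : ℕ → ℕ → List ℕ → List ℕ
shift i j xs = filter (0 <?_) (map (_∸ j) (drop i xs))

private
  drop-decreasing : ∀ i {xs} → Linked _≥_ xs → Linked _≥_ (drop i xs)
  drop-decreasing zero    xs↘       = xs↘
  drop-decreasing (suc i) []        = []
  drop-decreasing (suc i) [-]       = drop-decreasing i []
  drop-decreasing (suc i) (_ ∷ xs↘) = drop-decreasing i xs↘

  shift-decreasing : ∀ i j {xs} → Linked _≥_ xs → Linked _≥_ (shift i j xs)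
  shift-decreasing i j xs↘ =
    Linkedₚ.filter⁺ (0 <?_) (λ x≥y y≥z → ≤-trans y≥z x≥y)
      (Linkedₚ.map⁺ (Linked.map (∸-monoˡ-≤ j) (drop-decreasing i xs↘)))

infix 25 _[_,_]

_[_,_] : Partition → ℕ → ℕ → Partition
mkPartition xs xs↘ _ [ i , j ] =
  mkPartition (shift i j xs) (shift-decreasing i j xs↘) (all-filter (0 <?_) (map (_∸ j) (drop i xs)))

-- A moveset is a finite set of vectors, given by a list of its elements.
record Moveset : Set where
  constructor mkMoveset
  field
    vectors : List (ℕ × ℕ)
    nonzero : (0 , 0) ∉ vectors

open Moveset public

infix 4 _⊢_⟶_

_⊢_⟶_ : Moveset → Partition → Partition → Set
M ⊢ μ ⟶ ν = ∃[ i ] ∃[ j ] (i , j) ∈ vectors M × ν ≡ μ [ i , j ] × Nonempty ν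

options : Moveset → Partition → List Partition
options M μ = filter nonempty? (map (λ (i , j) → μ [ i , j ]) (vectors M))

∈-options⁺ : ∀ M μ {ν} → M ⊢ μ ⟶ ν → ν ∈ options M μ
∈-options⁺ M μ (_ , _ , v∈M , refl , ν≢[]) =
  ∈-filter⁺ nonempty? (∈-map⁺ (λ (i , j) → μ [ i , j ]) v∈M) ν≢[]

∈-options⁻ : ∀ M μ {ν} → ν ∈ options M μ → M ⊢ μ ⟶ ν
∈-options⁻ M μ {ν} ν∈ =
  let ν∈′ , ν≢[]         = ∈-filter⁻ nonempty? {v = ν} {xs = map (λ (i , j) → μ [ i , j ]) (vectors M)} ν∈
      (i , j) , v∈M , ν≡ = ∈-map⁻ (λ (i , j) → μ [ i , j ]) ν∈′
  in i , j , v∈M , ν≡ , ν≢[]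

private
  weight : List ℕ → ℕ
  weight []       = 0
  weight (x ∷ xs) = suc x + weight xs

  weight-drop : ∀ i xs → weight (drop i xs) ≤ weight xs
  weight-drop zero    xs       = ≤-refl
  weight-drop (suc i) []       = z≤n
  weight-drop (suc i) (x ∷ xs) = ≤-trans (weight-drop i xs) (m≤n+m _ (suc x))

  weight-trim : ∀ j xs → weight (filter (0 <?_) (map (_∸ j) xs)) ≤ weight xs
  weight-trim j []       = z≤n
  weight-trim j (x ∷ xs) with x ∸ j in eq
  ... | zero  = ≤-trans (weight-trim j xs) (m≤n+m _ (suc x))
  ... | suc y = +-mono-≤ (s≤s (subst (_≤ x) eq (m∸n≤m x j))) (weight-trim j xs)

  weight-shift : ∀ i j x xs → (i , j) ≢ (0 , 0) → weight (shift i j (x ∷ xs)) < weight (x ∷ xs)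
  weight-shift (suc i) j x xs _ =
    s≤s (≤-trans (weight-trim j (drop i xs)) (≤-trans (weight-drop i xs) (m≤n+m _ x)))
  weight-shift zero zero    x       xs ≢0 = ⊥-elim (≢0 refl)
  weight-shift zero (suc j) zero    xs _  = s≤s (weight-trim (suc j) xs)
  weight-shift zero (suc j) (suc x) xs _ with x ∸ j in eq
  ... | zero  = s≤s (≤-trans (weight-trim (suc j) xs) (m≤n+m _ (suc x)))
  ... | suc y = s≤s (+-mono-≤ (s≤s (subst (_≤ x) eq (m∸n≤m x j))) (weight-trim (suc j) xs))

_≺_ : Partition → Partition → Set
_≺_ = _<_ on (weight ∘ parts)

≺-wellFounded : WellFounded _≺_
≺-wellFounded = On.wellFounded (weight ∘ parts) <-wellFounded

⟶⇒≺ : ∀ M μ ν → M ⊢ μ ⟶ ν → ν ≺ μ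
⟶⇒≺ M (mkPartition []       _ _) _ (zero  , j , v∈M , refl , ν≢[]) = ⊥-elim (ν≢[] refl)
⟶⇒≺ M (mkPartition []       _ _) _ (suc i , j , v∈M , refl , ν≢[]) = ⊥-elim (ν≢[] refl)
⟶⇒≺ M (mkPartition (x ∷ xs) _ _) _ (i , j , v∈M , refl , ν≢[]) =
  weight-shift i j x xs λ ≡0 → nonzero M (subst (_∈ vectors M) ≡0 v∈M)

IsMex : List ℕ → ℕ → Set
IsMex xs t = t ∉ xs × (∀ {n} → n < t → n ∈ xs)

private
  search : List ℕ → ℕ → ℕ → ℕ
  search xs zero       k = k
  search xs (suc fuel) k with _∈?_ _≟_ k xs
  ... | yes _ = search xs fuel (suc k)
  ... | no  _ = k

  search-isMex : ∀ xs fuel k → (∀ {n} → n ∈ xs → n < k + fuel) → (∀ {n} → n < k → n ∈ xs) →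
                 IsMex xs (search xs fuel k)
  search-isMex xs zero k bound below =
    (λ k∈xs → <-irrefl (sym (+-identityʳ k)) (bound k∈xs)) , below
  search-isMex xs (suc fuel) k bound below with _∈?_ _≟_ k xs
  ... | no  k∉xs = k∉xs , below
  ... | yes k∈xs = search-isMex xs fuel (suc k)
    (λ n∈xs → ≤-trans (bound n∈xs) (≤-reflexive (+-suc k fuel)))
    λ { {n} (s≤s n≤k) → below′ n (m≤n⇒m<n∨m≡n n≤k) }
    where
    below′ : ∀ n → n < k ⊎ n ≡ k → n ∈ xs
    below′ n (inj₁ n<k)  = below n<k
    below′ n (inj₂ refl) = k∈xs

  ∈⇒≤sum : ∀ {n xs} → n ∈ xs → n ≤ sum xs
  ∈⇒≤sum (here refl)               = m≤m+n _ _
  ∈⇒≤sum {xs = x ∷ _} (there n∈xs) = ≤-trans (∈⇒≤sum n∈xs) (m≤n+m _ x)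

-- Every element of xs is at most sum xs, so the search succeeds by suc (sum xs).
mex : List ℕ → ℕ
mex xs = search xs (suc (sum xs)) 0

mex-isMex : ∀ xs → IsMex xs (mex xs)
mex-isMex xs = search-isMex xs (suc (sum xs)) 0 (s≤s ∘ ∈⇒≤sum) λ ()

-- The first argument is the value of a terminal position, the second the list
-- of values of the options.
mexWithTerminal : ℕ → List ℕ → ℕ
mexWithTerminal e []         = e
mexWithTerminal e xs@(_ ∷ _) = mex xs

private
  step : Moveset → ℕ → ∀ μ → WfRec _≺_ (λ _ → ℕ) μ → ℕ
  step M e μ rec = mexWithTerminal e
    (mapWith∈ (options M μ) λ {ν} ν∈ → rec {ν} (⟶⇒≺ M μ ν (∈-options⁻ M μ ν∈)))

value : Moveset → ℕ → Partition → ℕ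
value M e = All.wfRec ≺-wellFounded 0ℓ (λ _ → ℕ) (step M e)

value-unfold : ∀ M e μ → value M e μ ≡ mexWithTerminal e (map (value M e) (options M μ))
value-unfold M e μ = trans
  (FixPoint.unfold-wfRec ≺-wellFounded (λ _ → ℕ) (step M e)
    (λ ν ext → cong (mexWithTerminal e)
      (mapWith∈-cong (options M ν) _ _ λ {ρ} ν∈ → ext {ρ} (⟶⇒≺ M ν ρ (∈-options⁻ M ν ν∈)))))
  (cong (mexWithTerminal e) (mapWith∈≗map (value M e) (options M μ)))

sgValue misèreValue : Moveset → Partition → ℕ
sgValue     M = value M 0
misèreValue M = value M 1

Is⟨_,_⟩ : ℕ → ℕ → Moveset → Partition → Set
Is⟨ t , ℓ ⟩ M μ = sgValue M μ ≡ t × misèreValue M μ ≡ ℓ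

Terminal : Moveset → Partition → Set
Terminal M μ = ∀ ν → ¬ (M ⊢ μ ⟶ ν)

IsPositionOf : Moveset → Partition → Partition → Set
IsPositionOf M lam μ = Star (M ⊢_⟶_) lam μ

GameProperty : Set₁
GameProperty = Moveset → Partition → Set

Returnable : GameProperty
Returnable M lam = ∀ x y → IsPositionOf M lam x → M ⊢ x ⟶ y → ¬ Terminal M y →
  (Is⟨ 0 , 1 ⟩ M x → ∃[ z ] M ⊢ y ⟶ z × Is⟨ 0 , 1 ⟩ M z) ×
  (Is⟨ 1 , 0 ⟩ M x → ∃[ z ] M ⊢ y ⟶ z × Is⟨ 1 , 0 ⟩ M z)

Forced : GameProperty
Forced M lam = ∀ x y → IsPositionOf M lam x → M ⊢ x ⟶ y →
  (Is⟨ 0 , 1 ⟩ M x → Is⟨ 1 , 0 ⟩ M y) ×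
  (Is⟨ 1 , 0 ⟩ M x → Is⟨ 0 , 1 ⟩ M y)

Pet : GameProperty
Pet M lam = ∀ x → IsPositionOf M lam x →
  Is⟨ 0 , 1 ⟩ M x ⊎ Is⟨ 1 , 0 ⟩ M x ⊎ (∃[ k ] 2 ≤ k × Is⟨ k , k ⟩ M x)

FamilyHas FamilyLacks : GameProperty → Moveset → Pred Partition 0ℓ → Set
FamilyHas   Q M P = ∀ lam → P lam → Q M lam
FamilyLacks Q M P = ∃[ lam ] P lam × ¬ Q M lam

PetReturnableNotForced : Moveset → Pred Partition 0ℓ → Set
PetReturnableNotForced M P =
  FamilyHas Pet M P × FamilyHas Returnable M P × FamilyLacks Forced M P

Downright Pawn Knight King : Moveset
Downright = mkMoveset ((0 , 1) ∷ (1 , 0) ∷ [])           λ { (there (there ())) }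
Pawn      = mkMoveset ((0 , 1) ∷ (1 , 1) ∷ [])           λ { (there (there ())) }
Knight    = mkMoveset ((1 , 2) ∷ (2 , 1) ∷ [])           λ { (there (there ())) }
King      = mkMoveset ((0 , 1) ∷ (1 , 0) ∷ (1 , 1) ∷ []) λ { (there (there (there ()))) }

Rectangle : Pred Partition 0ℓ
Rectangle μ = ∃[ r ] ∃[ c ] 1 ≤ r × 1 ≤ c × parts μ ≡ replicate r c

Staircase : Pred Partition 0ℓ
Staircase μ = ∃[ k ] 1 ≤ k × parts μ ≡ applyDownFrom suc k

GeneralizedStaircase : Pred Partition 0ℓ
GeneralizedStaircase μ = ∃[ r ] ∃[ c ] ∃[ k ] 1 ≤ r × 1 ≤ c × 1 ≤ k ×
  parts μ ≡ concatMap (λ m → replicate r (m * c)) (applyDownFrom suc k)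

NonemptySubpartitionOfGeneralizedStaircase : Pred Partition 0ℓ
NonemptySubpartitionOfGeneralizedStaircase μ =
  ∃[ lam ] ∃[ i ] ∃[ j ] GeneralizedStaircase lam × μ ≡ lam [ i , j ] × Nonempty μ

{-# OPTIONS --safe #-}

-- A position all of whose options have a label (0,1), (1,0) or (k,k) with
-- k ≥ 2 has such a label itself as soon as it is terminal or one of its options
-- is (0,1) or (1,0). Returnability is a consequence of being pet.
--
-- In a game with two moves v and w, an offending position x would have two
-- (k,k)-options x[v] and x[w], so that x[2v], x[v+w], x[2w] would be labelled
-- alternately by (0,1) and (1,0). As every option of x[v+w] is an option of
-- x[2v] or of x[2w], this is possible only if x[v+w] is terminal and x[2v], x[2w]
-- are (1,0), which each of the two-move families excludes because x[2v] or x[2w]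
-- is then terminal as well.
module Submission where

open import Defs
open import Data.Empty using (⊥-elim)
open import Data.List.Base
  using (List; []; _∷_; _++_; map; filter; drop; replicate; concatMap; applyDownFrom)
open import Data.List.Membership.Propositional using (_∈_; _∉_)
open import Data.List.Membership.Propositional.Properties using (∈-map⁺; ∈-map⁻)
open import Data.List.Properties using (≡-dec; map-cong)
open import Data.List.Relation.Unary.All using (All; []; _∷_)
import Data.List.Relation.Unary.All as All
open import Data.List.Relation.Unary.Any using (here; there)
open import Data.List.Relation.Unary.Linked using (Linked; []; [-]; _∷_)
import Data.List.Relation.Unary.Linked as Linked
open import Data.Nat.Base
open import Data.Nat.Properties
open import Data.Product.Base using (_×_; _,_; ∃-syntax; proj₁; proj₂)
open import Data.Sum.Base using (_⊎_; inj₁; inj₂; [_,_]′; assocˡ)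
import Data.Sum.Base as Sum
open import Data.Unit.Base using (tt)
open import Function.Base using (_∘_; case_of_; id)
open import Induction.WellFounded using (Acc; acc)
open import Level using (0ℓ)
open import Relation.Binary.Construct.Closure.ReflexiveTransitive using (ε; _◅_; _◅◅_)
open import Relation.Binary.Definitions using (tri<; tri≈; tri>)
open import Relation.Binary.PropositionalEquality
  using (_≡_; _≢_; refl; sym; trans; cong; cong₂; subst; module ≡-Reasoning)
open import Relation.Nullary using (¬_; Dec; yes; no)
open import Relation.Nullary.Decidable using (True; recompute; toWitness)
open import Relation.Unary using (Pred; U)

-- Partitions as eventually zero weakly decreasing functions

nth : List ℕ → ℕ → ℕ
nth []       _       = 0
nth (x ∷ _)  zero    = x
nth (_ ∷ xs) (suc k) = nth xs k

nth-drop : ∀ i xs k → nth (drop i xs) k ≡ nth xs (i + k)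
nth-drop zero    _        _ = refl
nth-drop (suc i) []       _ = refl
nth-drop (suc i) (_ ∷ xs) k = nth-drop i xs k

nth-map-∸ : ∀ j xs k → nth (map (_∸ j) xs) k ≡ nth xs k ∸ j
nth-map-∸ j []       k       = sym (0∸n≡0 j)
nth-map-∸ j (_ ∷ _)  zero    = refl
nth-map-∸ j (_ ∷ xs) (suc k) = nth-map-∸ j xs k

nth-suc≤ : ∀ {xs} → Linked _≥_ xs → ∀ k → nth xs (suc k) ≤ nth xs k
nth-suc≤ []          _       = z≤n
nth-suc≤ [-]         _       = z≤n
nth-suc≤ (x≥y ∷ _)   zero    = x≥y
nth-suc≤ (_   ∷ xs↘) (suc k) = nth-suc≤ xs↘ k

-- In a weakly decreasing list the zeros form a trailing segment, and `nth` reads 0 past the end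
-- anyway, so deleting them changes nothing.
nth-filter : ∀ xs → (∀ k → nth xs (suc k) ≤ nth xs k) → ∀ k → nth (filter (0 <?_) xs) k ≡ nth xs k
nth-filter []           _   _       = refl
nth-filter (suc _ ∷ _)  _   zero    = refl
nth-filter (suc _ ∷ xs) xs↘ (suc k) = nth-filter xs (xs↘ ∘ suc) k
nth-filter (zero ∷ xs)  xs↘ k       =
  trans (nth-filter xs (xs↘ ∘ suc) k) (trans (≡0 (suc k)) (sym (≡0 k)))
  where
  ≡0 : ∀ k → nth (0 ∷ xs) k ≡ 0
  ≡0 zero    = refl
  ≡0 (suc k) = n≤0⇒n≡0 (≤-trans (xs↘ k) (≤-reflexive (≡0 k)))

nth-shift : ∀ i j {xs} → Linked _≥_ xs → ∀ k → nth (shift i j xs) k ≡ nth xs (i + k) ∸ j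
nth-shift i j {xs} xs↘ k = trans (nth-filter (map (_∸ j) (drop i xs)) decreasing k) (unfiltered k)
  where
  unfiltered : ∀ k → nth (map (_∸ j) (drop i xs)) k ≡ nth xs (i + k) ∸ j
  unfiltered k = trans (nth-map-∸ j (drop i xs) k) (cong (_∸ j) (nth-drop i xs k))

  decreasing : ∀ k → nth (map (_∸ j) (drop i xs)) (suc k) ≤ nth (map (_∸ j) (drop i xs)) k
  decreasing k rewrite unfiltered (suc k) | unfiltered k | +-suc i k = ∸-monoˡ-≤ j (nth-suc≤ xs↘ (i + k))

-- Positivity lets the length be read off as the first index where `nth` is 0.
nth-injective : ∀ {xs ys} → All (0 <_) xs → All (0 <_) ys → (∀ k → nth xs k ≡ nth ys k) → xs ≡ ys
nth-injective []       []       _  = refl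
nth-injective []       (p ∷ _)  eq = ⊥-elim (<-irrefl (eq 0) p)
nth-injective (p ∷ _)  []       eq = ⊥-elim (<-irrefl (sym (eq 0)) p)
nth-injective (_ ∷ ps) (_ ∷ qs) eq = cong₂ _∷_ (eq 0) (nth-injective ps qs (eq ∘ suc))

row : Partition → ℕ → ℕ
row μ = nth (parts μ)

parts-injective : ∀ {μ ν} → parts μ ≡ parts ν → μ ≡ ν
parts-injective refl = refl

row-injective : ∀ μ ν → (∀ k → row μ k ≡ row ν k) → μ ≡ ν
row-injective (mkPartition xs _ xs⁺) (mkPartition ys _ ys⁺) eq =
  -- Positivity is available only irrelevantly; decidable equality of lists recovers a relevant
  -- proof.
  parts-injective (recompute (≡-dec _≟_ xs ys) (nth-injective xs⁺ ys⁺ eq))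

row-shift : ∀ μ i j k → row (μ [ i , j ]) k ≡ row μ (i + k) ∸ j
row-shift (mkPartition _ xs↘ _) i j k = recompute (_ ≟ _) (nth-shift i j xs↘ k)

row-suc≤ : ∀ μ k → row μ (suc k) ≤ row μ k
row-suc≤ (mkPartition _ xs↘ _) k = recompute (_ ≤? _) (nth-suc≤ xs↘ k)

Nonempty⇒0<row : ∀ μ → Nonempty μ → 0 < row μ 0
Nonempty⇒0<row (mkPartition []      _ _)   ≢[] = ⊥-elim (≢[] refl)
Nonempty⇒0<row (mkPartition (_ ∷ _) _ xs⁺) _   = recompute (_ ≤? _) (All.head xs⁺)

0<row⇒Nonempty : ∀ μ → 0 < row μ 0 → Nonempty μ
0<row⇒Nonempty (mkPartition (_ ∷ _) _ _) _ ()

row₀-shift : ∀ μ i j → row (μ [ i , j ]) 0 ≡ row μ i ∸ j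
row₀-shift μ i j = trans (row-shift μ i j 0) (cong (λ k → row μ k ∸ j) (+-identityʳ i))

Nonempty⇒<row : ∀ μ i j → Nonempty (μ [ i , j ]) → j < row μ i
Nonempty⇒<row μ i j ≢[] =
  m∸n≢0⇒n<m (n>0⇒n≢0 (subst (0 <_) (row₀-shift μ i j) (Nonempty⇒0<row (μ [ i , j ]) ≢[])))

<row⇒Nonempty : ∀ μ i j → j < row μ i → Nonempty (μ [ i , j ])
<row⇒Nonempty μ i j j< =
  0<row⇒Nonempty (μ [ i , j ]) (subst (0 <_) (sym (row₀-shift μ i j)) (m<n⇒0<n∸m j<))

Nonempty-unshift : ∀ μ i j → Nonempty (μ [ i , j ]) → Nonempty μ
Nonempty-unshift (mkPartition _ _ _) zero    j ≢[] refl = ≢[] refl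
Nonempty-unshift (mkPartition _ _ _) (suc _) j ≢[] refl = ≢[] refl

shift-shift : ∀ μ i j i′ j′ → μ [ i , j ] [ i′ , j′ ] ≡ μ [ i + i′ , j + j′ ]
shift-shift μ i j i′ j′ = row-injective _ _ λ k → begin
  row (μ [ i , j ] [ i′ , j′ ]) k ≡⟨ row-shift (μ [ i , j ]) i′ j′ k ⟩
  row (μ [ i , j ]) (i′ + k) ∸ j′ ≡⟨ cong (_∸ j′) (row-shift μ i j (i′ + k)) ⟩
  row μ (i + (i′ + k)) ∸ j ∸ j′   ≡⟨ ∸-+-assoc _ j j′ ⟩
  row μ (i + (i′ + k)) ∸ (j + j′) ≡⟨ cong (λ n → row μ n ∸ (j + j′)) (+-assoc i i′ k) ⟨
  row μ (i + i′ + k) ∸ (j + j′)   ≡⟨ row-shift μ (i + i′) (j + j′) k ⟨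
  row (μ [ i + i′ , j + j′ ]) k   ∎
  where open ≡-Reasoning

shift-comm : ∀ μ i j i′ j′ → μ [ i , j ] [ i′ , j′ ] ≡ μ [ i′ , j′ ] [ i , j ]
shift-comm μ i j i′ j′ = trans (shift-shift μ i j i′ j′)
  (trans (cong₂ (μ [_,_]) (+-comm i i′) (+-comm j j′)) (sym (shift-shift μ i′ j′ i j)))

-- Options are shifts, so such a class contains every position of the games that start in it.
ShiftClosed : Pred Partition 0ℓ → Set
ShiftClosed P = ∀ μ i j → P μ → P (μ [ i , j ])

-- Labels of positions

Tame : Moveset → Pred Partition 0ℓ
Tame M μ = Is⟨ 0 , 1 ⟩ M μ ⊎ Is⟨ 1 , 0 ⟩ M μ ⊎ (∃[ k ] 2 ≤ k × Is⟨ k , k ⟩ M μ)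

module Grundy (M : Moveset) where

  private variable
    x y z : Partition
    n : ℕ

  terminal? : ∀ x → Terminal M x ⊎ ∃[ y ] M ⊢ x ⟶ y
  terminal? x with options M x in eq
  ... | []    = inj₁ λ y x⟶y → case-[] (subst (y ∈_) eq (∈-options⁺ M x x⟶y))
    where
    case-[] : ∀ {y} → y ∉ []
    case-[] ()
  ... | y ∷ _ = inj₂ (y , ∈-options⁻ M x (subst (y ∈_) (sym eq) (here refl)))

  nonterminal⇒option : ∀ x → ¬ Terminal M x → ∃[ y ] M ⊢ x ⟶ y
  nonterminal⇒option x ¬x↛ = [ (λ x↛ → ⊥-elim (¬x↛ x↛)) , id ]′ (terminal? x)

  terminal⇒value : ∀ e → Terminal M x → value M e x ≡ e
  terminal⇒value {x} e x↛ = trans (value-unfold M e x)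
    (cong (mexWithTerminal e ∘ map (value M e)) (no-options (options M x) λ y → x↛ y ∘ ∈-options⁻ M x))
    where
    no-options : ∀ ys → (∀ y → y ∉ ys) → ys ≡ []
    no-options []      _  = refl
    no-options (y ∷ _) ∉ = ⊥-elim (∉ y (here refl))

  -- Unlike value, which recurses on accessibility proofs, unrolled evaluates
  -- quickly on closed positions, provided that the depth n exceeds the length of
  -- every play.
  unrolled : ℕ → ℕ → Partition → ℕ
  unrolled e zero    x = value M e x
  unrolled e (suc n) x = mexWithTerminal e (map (unrolled e n) (options M x))

  unroll-value : ∀ e n x → value M e x ≡ unrolled e n x
  unroll-value e zero    x = refl
  unroll-value e (suc n) x = trans (value-unfold M e x)
    (cong (mexWithTerminal e) (map-cong (unroll-value e n) (options M x)))

  value-isMex : ∀ e → M ⊢ x ⟶ y → IsMex (map (value M e) (options M x)) (value M e x)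
  value-isMex {x} e x⟶y =
    subst (IsMex _) (sym (value-unfold M e x)) (isMex (∈-options⁺ M x x⟶y))
    where
    -- The option list is generalized so that `mexWithTerminal` reduces once membership shows the
    -- list to be nonempty.
    isMex : ∀ {ys} → y ∈ ys → IsMex (map (value M e) ys) (mexWithTerminal e (map (value M e) ys))
    isMex {ys = _ ∷ _} _ = mex-isMex _

  option-value≢ : ∀ e → M ⊢ x ⟶ y → value M e y ≢ value M e x
  option-value≢ {x} e x⟶y eq = proj₁ (value-isMex e x⟶y)
    (subst (_∈ map (value M e) (options M x)) eq (∈-map⁺ (value M e) (∈-options⁺ M x x⟶y)))

  option-with-value : ∀ e → M ⊢ x ⟶ y → n < value M e x → ∃[ z ] M ⊢ x ⟶ z × value M e z ≡ n
  option-with-value {x} e x⟶y n< =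
    let z , z∈ , n≡ = ∈-map⁻ (value M e) (proj₂ (value-isMex e x⟶y) n<)
    in z , ∈-options⁻ M x z∈ , sym n≡

  01-10-disjoint : ∀ x → Is⟨ 0 , 1 ⟩ M x → ¬ Is⟨ 1 , 0 ⟩ M x
  01-10-disjoint _ (s≡0 , _) (s≡1 , _) = 0≢1+n (trans (sym s≡0) s≡1)

  -- Among tame labels, one coordinate equal to 0 or 1 determines the other. This and the next three
  -- lemmas complete a value found by `option-with-value` to a label.
  tame∧sg≡0 : Tame M x → sgValue M x ≡ 0 → Is⟨ 0 , 1 ⟩ M x
  tame∧sg≡0 (inj₁ x01)                         _   = x01
  tame∧sg≡0 (inj₂ (inj₁ (s≡1 , _)))            s≡0 = ⊥-elim (0≢1+n (trans (sym s≡0) s≡1))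
  tame∧sg≡0 (inj₂ (inj₂ (_ , 2≤k , s≡k , _))) s≡0 = ⊥-elim (n≮0 (subst (2 ≤_) (trans (sym s≡k) s≡0) 2≤k))

  tame∧sg≡1 : Tame M x → sgValue M x ≡ 1 → Is⟨ 1 , 0 ⟩ M x
  tame∧sg≡1 (inj₁ (s≡0 , _))                   s≡1 = ⊥-elim (0≢1+n (trans (sym s≡0) s≡1))
  tame∧sg≡1 (inj₂ (inj₁ x10))                  _   = x10
  tame∧sg≡1 (inj₂ (inj₂ (_ , 2≤k , s≡k , _))) s≡1 = ⊥-elim (n≮n 1 (subst (2 ≤_) (trans (sym s≡k) s≡1) 2≤k))

  tame∧misère≡0 : Tame M x → misèreValue M x ≡ 0 → Is⟨ 1 , 0 ⟩ M x
  tame∧misère≡0 (inj₁ (_ , m≡1))                   m≡0 = ⊥-elim (0≢1+n (trans (sym m≡0) m≡1))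
  tame∧misère≡0 (inj₂ (inj₁ x10))                  _   = x10
  tame∧misère≡0 (inj₂ (inj₂ (_ , 2≤k , _ , m≡k))) m≡0 = ⊥-elim (n≮0 (subst (2 ≤_) (trans (sym m≡k) m≡0) 2≤k))

  tame∧misère≡1 : Tame M x → misèreValue M x ≡ 1 → Is⟨ 0 , 1 ⟩ M x
  tame∧misère≡1 (inj₁ x01)                         _   = x01
  tame∧misère≡1 (inj₂ (inj₁ (_ , m≡0)))            m≡1 = ⊥-elim (0≢1+n (trans (sym m≡0) m≡1))
  tame∧misère≡1 (inj₂ (inj₂ (_ , 2≤k , _ , m≡k))) m≡1 = ⊥-elim (n≮n 1 (subst (2 ≤_) (trans (sym m≡k) m≡1) 2≤k))

  tame∧2≤sg : Tame M x → 2 ≤ sgValue M x → misèreValue M x ≡ sgValue M x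
  tame∧2≤sg (inj₁ (s≡0 , _))                     2≤s = ⊥-elim (n≮0 (subst (2 ≤_) s≡0 2≤s))
  tame∧2≤sg (inj₂ (inj₁ (s≡1 , _)))              2≤s = ⊥-elim (n≮n 1 (subst (2 ≤_) s≡1 2≤s))
  tame∧2≤sg (inj₂ (inj₂ (_ , _ , s≡k , m≡k))) _   = trans m≡k (sym s≡k)

  tame∧2≤misère : Tame M x → 2 ≤ misèreValue M x → sgValue M x ≡ misèreValue M x
  tame∧2≤misère (inj₁ (_ , m≡1))                     2≤m = ⊥-elim (n≮n 1 (subst (2 ≤_) m≡1 2≤m))
  tame∧2≤misère (inj₂ (inj₁ (_ , m≡0)))              2≤m = ⊥-elim (n≮0 (subst (2 ≤_) m≡0 2≤m))
  tame∧2≤misère (inj₂ (inj₂ (_ , _ , s≡k , m≡k))) _   = trans s≡k (sym m≡k)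

  -- If the values differed, the smaller would lie below the other mex and so be attained by an
  -- option in the other convention. That option is tame with a value at least 2, so both of its
  -- values agree, and it shares a value with `x` in one convention.
  tame-big : M ⊢ x ⟶ y → (∀ {z} → M ⊢ x ⟶ z → Tame M z) →
             2 ≤ sgValue M x → 2 ≤ misèreValue M x → Tame M x
  tame-big {x} x⟶y tame 2≤s 2≤m = case <-cmp (sgValue M x) (misèreValue M x) of λ where
    (tri≈ _ s≡m _) → inj₂ (inj₂ (_ , 2≤s , refl , sym s≡m))
    (tri< s<m _ _) →
      let z , x⟶z , mz≡s = option-with-value 1 x⟶y s<m
          sz≡mz = tame∧2≤misère (tame x⟶z) (subst (2 ≤_) (sym mz≡s) 2≤s)
      in ⊥-elim (option-value≢ 0 x⟶z (trans sz≡mz mz≡s))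
    (tri> _ _ m<s) →
      let z , x⟶z , sz≡m = option-with-value 0 x⟶y m<s
          mz≡sz = tame∧2≤sg (tame x⟶z) (subst (2 ≤_) (sym sz≡m) 2≤m)
      in ⊥-elim (option-value≢ 1 x⟶z (trans mz≡sz sz≡m))

  ≢0∧≢1⇒2≤ : n ≢ 0 → n ≢ 1 → 2 ≤ n
  ≢0∧≢1⇒2≤ {zero}        n≢0 _   = ⊥-elim (n≢0 refl)
  ≢0∧≢1⇒2≤ {suc zero}    _   n≢1 = ⊥-elim (n≢1 refl)
  ≢0∧≢1⇒2≤ {suc (suc _)} _   _   = s≤s (s≤s z≤n)

  -- A (0,1)-option excludes Sprague-Grundy value 0 and misère value 1. Sprague-Grundy value 1 and
  -- misère value 0 then imply each other, since a witness to the contrary would be a (1,0)-option;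
  -- if neither holds, `tame-big` applies. A (1,0)-option is treated dually.
  tame-step : M ⊢ x ⟶ y → Is⟨ 0 , 1 ⟩ M y ⊎ Is⟨ 1 , 0 ⟩ M y →
              (∀ {z} → M ⊢ x ⟶ z → Tame M z) → Tame M x
  tame-step {x} x⟶y (inj₁ (sy≡0 , my≡1)) tame = by-misère (misèreValue M x ≟ 0)
    where
    s≢0 : sgValue M x ≢ 0
    s≢0 s≡0 = option-value≢ 0 x⟶y (trans sy≡0 (sym s≡0))

    m≢1 : misèreValue M x ≢ 1
    m≢1 m≡1 = option-value≢ 1 x⟶y (trans my≡1 (sym m≡1))

    by-misère : Dec (misèreValue M x ≡ 0) → Tame M x
    by-misère (yes m≡0) = inj₂ (inj₁ (≤-antisym (≮⇒≥ s≯1) (n≢0⇒n>0 s≢0) , m≡0))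
      where
      s≯1 : ¬ (1 < sgValue M x)
      s≯1 1<s =
        let z , x⟶z , sz≡1 = option-with-value 0 x⟶y 1<s
            _ , mz≡0 = tame∧sg≡1 (tame x⟶z) sz≡1
        in option-value≢ 1 x⟶z (trans mz≡0 (sym m≡0))
    by-misère (no m≢0) = tame-big x⟶y tame (≢0∧≢1⇒2≤ s≢0 s≢1) (≢0∧≢1⇒2≤ m≢0 m≢1)
      where
      s≢1 : sgValue M x ≢ 1
      s≢1 s≡1 =
        let z , x⟶z , mz≡0 = option-with-value 1 x⟶y (n≢0⇒n>0 m≢0)
            sz≡1 , _ = tame∧misère≡0 (tame x⟶z) mz≡0
        in option-value≢ 0 x⟶z (trans sz≡1 (sym s≡1))
  tame-step {x} x⟶y (inj₂ (sy≡1 , my≡0)) tame = by-sg (sgValue M x ≟ 0)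
    where
    s≢1 : sgValue M x ≢ 1
    s≢1 s≡1 = option-value≢ 0 x⟶y (trans sy≡1 (sym s≡1))

    m≢0 : misèreValue M x ≢ 0
    m≢0 m≡0 = option-value≢ 1 x⟶y (trans my≡0 (sym m≡0))

    by-sg : Dec (sgValue M x ≡ 0) → Tame M x
    by-sg (yes s≡0) = inj₁ (s≡0 , ≤-antisym (≮⇒≥ m≯1) (n≢0⇒n>0 m≢0))
      where
      m≯1 : ¬ (1 < misèreValue M x)
      m≯1 1<m =
        let z , x⟶z , mz≡1 = option-with-value 1 x⟶y 1<m
            sz≡0 , _ = tame∧misère≡1 (tame x⟶z) mz≡1
        in option-value≢ 0 x⟶z (trans sz≡0 (sym s≡0))
    by-sg (no s≢0) = tame-big x⟶y tame (≢0∧≢1⇒2≤ s≢0 s≢1) (≢0∧≢1⇒2≤ m≢0 m≢1)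
      where
      m≢1 : misèreValue M x ≢ 1
      m≢1 m≡1 =
        let z , x⟶z , sz≡0 = option-with-value 0 x⟶y (n≢0⇒n>0 s≢0)
            _ , mz≡1 = tame∧sg≡0 (tame x⟶z) sz≡0
        in option-value≢ 1 x⟶z (trans mz≡1 (sym m≡1))

  -- Both values of `x` are positive mexes, so 0 occurs among the options in each convention;
  -- tameness completes the labels.
  big-options : ∀ x → 2 ≤ n → Is⟨ n , n ⟩ M x → (∀ {z} → M ⊢ x ⟶ z → Tame M z) →
                (∃[ z ] M ⊢ x ⟶ z × Is⟨ 0 , 1 ⟩ M z) × (∃[ z ] M ⊢ x ⟶ z × Is⟨ 1 , 0 ⟩ M z)
  big-options x 2≤n (s≡n , m≡n) tame =
    let z₀ , x⟶z₀ , sz₀≡0 = option-with-value 0 x⟶ 0<s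
        z₁ , x⟶z₁ , mz₁≡0 = option-with-value 1 x⟶ (subst (0 <_) (trans s≡n (sym m≡n)) 0<s)
    in (z₀ , x⟶z₀ , tame∧sg≡0 (tame x⟶z₀) sz₀≡0) , (z₁ , x⟶z₁ , tame∧misère≡0 (tame x⟶z₁) mz₁≡0)
    where
    0<s : 0 < sgValue M x
    0<s = ≤-trans (s≤s z≤n) (subst (2 ≤_) (sym s≡n) 2≤n)

    x⟶ : M ⊢ x ⟶ _
    x⟶ = proj₂ (nonterminal⇒option x λ x↛ → n≮0 (subst (0 <_) (terminal⇒value 0 x↛) 0<s))

  -- An option of a (0,1)-position has nonzero Sprague-Grundy value, so if nonterminal it has an
  -- option of value 0, which is (0,1) in a pet game. For (1,0) the misère values are used.
  pet⇒returnable : ∀ {P} → FamilyHas Pet M P → FamilyHas Returnable M P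
  pet⇒returnable pet lam lam∈P x y lam⟶*x x⟶y y-nonterminal =
    (λ (sx≡0 , _) →
      let sy≢0 = λ sy≡0 → option-value≢ 0 x⟶y (trans sy≡0 (sym sx≡0))
          z , y⟶z , sz≡0 = option-with-value 0 y⟶ (n≢0⇒n>0 sy≢0)
      in z , y⟶z , tame∧sg≡0 (tame y⟶z) sz≡0) ,
    (λ (_ , mx≡0) →
      let my≢0 = λ my≡0 → option-value≢ 1 x⟶y (trans my≡0 (sym mx≡0))
          z , y⟶z , mz≡0 = option-with-value 1 y⟶ (n≢0⇒n>0 my≢0)
      in z , y⟶z , tame∧misère≡0 (tame y⟶z) mz≡0)
    where
    y⟶ : M ⊢ y ⟶ proj₁ (nonterminal⇒option y y-nonterminal)
    y⟶ = proj₂ (nonterminal⇒option y y-nonterminal)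

    tame : ∀ {z} → M ⊢ y ⟶ z → Tame M z
    tame {z} y⟶z = pet lam lam∈P z (lam⟶*x ◅◅ x⟶y ◅ y⟶z ◅ ε)

  -- Tameness is assumed of all smaller positions in `P`, because the arguments inspect options of
  -- options.
  Escapes : Pred Partition 0ℓ → Set
  Escapes P = ∀ x {y} → P x → M ⊢ x ⟶ y → (∀ z → P z → z ≺ x → Tame M z) →
              ∃[ z ] M ⊢ x ⟶ z × (Is⟨ 0 , 1 ⟩ M z ⊎ Is⟨ 1 , 0 ⟩ M z)

  module _ {P : Pred Partition 0ℓ} (closed : ShiftClosed P) where

    option-closed : ∀ x y → P x → M ⊢ x ⟶ y → P y
    option-closed x _ x∈P (i , j , _ , refl , _) = closed x i j x∈P

    position-closed : P x → IsPositionOf M x y → P y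
    position-closed x∈P ε = x∈P
    position-closed {x} x∈P (_◅_ {j = z} x⟶z z⟶*y) = position-closed (option-closed x z x∈P x⟶z) z⟶*y

    escapes⇒tame : Escapes P → ∀ x → P x → Tame M x
    escapes⇒tame escape x = go x (≺-wellFounded x)
      where
      go : ∀ x → Acc _≺_ x → P x → Tame M x
      go x (acc rec) x∈P = case terminal? x of λ where
        (inj₁ x↛)         → inj₁ (terminal⇒value 0 x↛ , terminal⇒value 1 x↛)
        (inj₂ (_ , x⟶y)) →
          let _ , x⟶z , label = escape x x∈P x⟶y (λ z z∈P z≺x → go z (rec z≺x) z∈P)
          in tame-step x⟶z label λ {w} x⟶w →
               go w (rec (⟶⇒≺ M x w x⟶w)) (option-closed x w x∈P x⟶w)

    escapes⇒pet : Escapes P → FamilyHas Pet M P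
    escapes⇒pet escape lam lam∈P x lam⟶*x = escapes⇒tame escape x (position-closed lam∈P lam⟶*x)

  01-with-big-option⇒¬forced : ∀ {x y} → Is⟨ 0 , 1 ⟩ M x → M ⊢ x ⟶ y → sgValue M y ≡ 2 → ¬ Forced M x
  01-with-big-option⇒¬forced {x} {y} x01 x⟶y sy≡2 forced =
    1+n≢n (trans (sym sy≡2) (proj₁ (proj₁ (forced x y ε x⟶y) x01)))

  move : ∀ x {i j} → (i , j) ∈ vectors M → Nonempty (x [ i , j ]) → M ⊢ x ⟶ x [ i , j ]
  move _ v∈M ≢[] = _ , _ , v∈M , refl , ≢[]

  -- With the converse below, this turns `Cornered` into inequalities between rows.
  terminal⇒row≤ : ∀ μ i j {i′ j′} → Terminal M (μ [ i , j ]) → (i′ , j′) ∈ vectors M →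
                  row μ (i + i′) ≤ j + j′
  terminal⇒row≤ μ i j {i′} {j′} ↛ v∈M = ≮⇒≥ λ j+j′< →
    ↛ _ (move (μ [ i , j ]) v∈M (subst Nonempty (sym (shift-shift μ i j i′ j′))
                          (<row⇒Nonempty μ (i + i′) (j + j′) j+j′<)))

  row≤⇒terminal : ∀ μ i j → (∀ {i′ j′} → (i′ , j′) ∈ vectors M → row μ (i + i′) ≤ j + j′) →
                  Terminal M (μ [ i , j ])
  row≤⇒terminal μ i j row≤ _ (i′ , j′ , v∈M , refl , ≢[]) =
    <⇒≱ (Nonempty⇒<row μ _ _ (subst Nonempty (shift-shift μ i j i′ j′) ≢[])) (row≤ v∈M)

-- Games with two moves

module TwoMoves {i₁ j₁ i₂ j₂ : ℕ} (0∉ : (0 , 0) ∉ (i₁ , j₁) ∷ (i₂ , j₂) ∷ []) where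

  M : Moveset
  M = mkMoveset ((i₁ , j₁) ∷ (i₂ , j₂) ∷ []) 0∉

  open Grundy M

  Cornered : Pred Partition 0ℓ → Set
  Cornered P = ∀ x → P x →
    j₁ + j₁ < row x (i₁ + i₁) → j₁ + j₂ < row x (i₁ + i₂) → j₂ + j₂ < row x (i₂ + i₂) →
    Terminal M (x [ i₁ + i₂ , j₁ + j₂ ]) →
    Terminal M (x [ i₁ + i₁ , j₁ + j₁ ]) ⊎ Terminal M (x [ i₂ + i₂ , j₂ + j₂ ])

  module _ {P : Pred Partition 0ℓ} (closed : ShiftClosed P) (cornered : Cornered P) where

    escapes : Escapes P
    escapes x x∈P x⟶ tame = escape x⟶
      where
      y z p q r : Partition
      y = x [ i₁ , j₁ ]
      z = x [ i₂ , j₂ ]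
      p = x [ i₁ + i₁ , j₁ + j₁ ]
      q = x [ i₁ + i₂ , j₁ + j₂ ]
      r = x [ i₂ + i₂ , j₂ + j₂ ]

      yz≡q : y [ i₂ , j₂ ] ≡ q
      yz≡q = shift-shift x i₁ j₁ i₂ j₂

      zy≡q : z [ i₁ , j₁ ] ≡ q
      zy≡q = trans (shift-comm x i₂ j₂ i₁ j₁) yz≡q

      y-options : ∀ {w} → M ⊢ y ⟶ w → (w ≡ p ⊎ w ≡ q) × Nonempty w
      y-options (_ , _ , here refl         , refl , ≢[]) = inj₁ (shift-shift x i₁ j₁ i₁ j₁) , ≢[]
      y-options (_ , _ , there (here refl) , refl , ≢[]) = inj₂ yz≡q , ≢[]

      z-options : ∀ {w} → M ⊢ z ⟶ w → (w ≡ r ⊎ w ≡ q) × Nonempty w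
      z-options (_ , _ , here refl         , refl , ≢[]) = inj₂ zy≡q , ≢[]
      z-options (_ , _ , there (here refl) , refl , ≢[]) = inj₁ (shift-shift x i₂ j₂ i₂ j₂) , ≢[]

      -- For moves v and w this is (v+w)+v = 2v+w and (v+w)+w = 2w+v.
      p-or-r : ∀ {w} → M ⊢ q ⟶ w → M ⊢ p ⟶ w ⊎ M ⊢ r ⟶ w
      p-or-r (_ , _ , here refl , refl , ≢[]) = inj₁ (_ , _ , there (here refl) , eq , ≢[])
        where
        open ≡-Reasoning
        eq : q [ i₁ , j₁ ] ≡ p [ i₂ , j₂ ]
        eq = begin
          q [ i₁ , j₁ ]               ≡⟨ cong _[ i₁ , j₁ ] yz≡q ⟨
          y [ i₂ , j₂ ] [ i₁ , j₁ ]   ≡⟨ shift-comm y i₂ j₂ i₁ j₁ ⟩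
          y [ i₁ , j₁ ] [ i₂ , j₂ ]   ≡⟨ cong _[ i₂ , j₂ ] (shift-shift x i₁ j₁ i₁ j₁) ⟩
          p [ i₂ , j₂ ]               ∎
      p-or-r (_ , _ , there (here refl) , refl , ≢[]) = inj₂ (_ , _ , here refl , eq , ≢[])
        where
        open ≡-Reasoning
        eq : q [ i₂ , j₂ ] ≡ r [ i₁ , j₁ ]
        eq = begin
          q [ i₂ , j₂ ]               ≡⟨ cong _[ i₂ , j₂ ] zy≡q ⟨
          z [ i₁ , j₁ ] [ i₂ , j₂ ]   ≡⟨ shift-comm z i₁ j₁ i₂ j₂ ⟩
          z [ i₂ , j₂ ] [ i₁ , j₁ ]   ≡⟨ cong _[ i₁ , j₁ ] (shift-shift x i₂ j₂ i₂ j₂) ⟩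
          r [ i₁ , j₁ ]               ∎

      -- Once nonterminal, `q` has an option of misère value 0, which is also an option of `p` or
      -- `r`, themselves of misère value 0.
      ¬10-01-10 : Nonempty p → Nonempty q → Nonempty r →
                  Is⟨ 1 , 0 ⟩ M p → Is⟨ 0 , 1 ⟩ M q → ¬ Is⟨ 1 , 0 ⟩ M r
      ¬10-01-10 p≢[] q≢[] r≢[] (sp≡1 , mp≡0) (_ , mq≡1) (sr≡1 , mr≡0) =
        let _ , q⟶w , mw≡0 = option-with-value 1 (proj₂ (nonterminal⇒option q q-nonterminal))
                                               (subst (0 <_) (sym mq≡1) (s≤s z≤n))
        in [ (λ p⟶w → option-value≢ 1 p⟶w (trans mw≡0 (sym mp≡0)))
           , (λ r⟶w → option-value≢ 1 r⟶w (trans mw≡0 (sym mr≡0))) ]′ (p-or-r q⟶w)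
        where
        q-nonterminal : ¬ Terminal M q
        q-nonterminal q↛ =
          [ (λ p↛ → 0≢1+n (trans (sym (terminal⇒value 0 p↛)) sp≡1))
          , (λ r↛ → 0≢1+n (trans (sym (terminal⇒value 0 r↛)) sr≡1))
          ]′ (cornered x x∈P (Nonempty⇒<row x _ _ p≢[]) (Nonempty⇒<row x _ _ q≢[])
                           (Nonempty⇒<row x _ _ r≢[]) q↛)

      -- The dual argument with Sprague-Grundy values; `q` is nonterminal because its value is 1.
      ¬01-10-01 : Is⟨ 0 , 1 ⟩ M p → Is⟨ 1 , 0 ⟩ M q → ¬ Is⟨ 0 , 1 ⟩ M r
      ¬01-10-01 (sp≡0 , _) (sq≡1 , _) (sr≡0 , _) =
        let _ , q⟶w , sw≡0 = option-with-value 0 (proj₂ (nonterminal⇒option q q-nonterminal))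
                                               (subst (0 <_) (sym sq≡1) (s≤s z≤n))
        in [ (λ p⟶w → option-value≢ 0 p⟶w (trans sw≡0 (sym sp≡0)))
           , (λ r⟶w → option-value≢ 0 r⟶w (trans sw≡0 (sym sr≡0))) ]′ (p-or-r q⟶w)
        where
        q-nonterminal : ¬ Terminal M q
        q-nonterminal q↛ = 0≢1+n (trans (sym (terminal⇒value 0 q↛)) sq≡1)

      Big : Pred Partition 0ℓ
      Big w = ∃[ k ] 2 ≤ k × Is⟨ k , k ⟩ M w

      Labels : Partition → Partition → Set
      Labels v w = Nonempty v × Nonempty w ×
        (Is⟨ 0 , 1 ⟩ M v × Is⟨ 1 , 0 ⟩ M w ⊎ Is⟨ 1 , 0 ⟩ M v × Is⟨ 0 , 1 ⟩ M w)

      -- A big `u` has options of both labels, and only `v` and `w` can be options, so each carries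
      -- one label.
      labels : ∀ {u v w} → M ⊢ x ⟶ u → (∀ {t} → M ⊢ u ⟶ t → (t ≡ v ⊎ t ≡ w) × Nonempty t) →
               Big u → Labels v w
      labels {u} {v} {w} x⟶u u-options (_ , 2≤k , u≡k) =
        let (a , u⟶a , a01) , (b , u⟶b , b10) = big-options u 2≤k u≡k λ {t} u⟶t →
              tame t (option-closed {P} closed u t (option-closed {P} closed x u x∈P x⟶u) u⟶t)
                   (<-trans (⟶⇒≺ M u t u⟶t) (⟶⇒≺ M x u x⟶u))
        in distinguish (u-options u⟶a) a01 (u-options u⟶b) b10
        where
        distinguish : ∀ {a b} → (a ≡ v ⊎ a ≡ w) × Nonempty a → Is⟨ 0 , 1 ⟩ M a →
                      (b ≡ v ⊎ b ≡ w) × Nonempty b → Is⟨ 1 , 0 ⟩ M b → Labels v w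
        distinguish (inj₁ refl , v≢[]) a01 (inj₂ refl , w≢[]) b10 = v≢[] , w≢[] , inj₁ (a01 , b10)
        distinguish (inj₂ refl , w≢[]) a01 (inj₁ refl , v≢[]) b10 = v≢[] , w≢[] , inj₂ (b10 , a01)
        distinguish (inj₁ refl , _)    a01 (inj₁ refl , _)    b10 = ⊥-elim (01-10-disjoint _ a01 b10)
        distinguish (inj₂ refl , _)    a01 (inj₂ refl , _)    b10 = ⊥-elim (01-10-disjoint _ a01 b10)

      -- The shared `q` forces `p` and `r` to have the same label, opposite to its own.
      ¬consistent : Labels p q → ¬ Labels r q
      ¬consistent (_ , _ , inj₁ (p01 , q10)) (_ , _ , inj₁ (r01 , _)) = ¬01-10-01 p01 q10 r01
      ¬consistent (p≢[] , q≢[] , inj₂ (p10 , q01)) (r≢[] , _ , inj₂ (r10 , _)) =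
        ¬10-01-10 p≢[] q≢[] r≢[] p10 q01 r10
      ¬consistent (_ , _ , inj₁ (_ , q10)) (_ , _ , inj₂ (_ , q01)) = 01-10-disjoint q q01 q10
      ¬consistent (_ , _ , inj₂ (_ , q01)) (_ , _ , inj₁ (_ , q10)) = 01-10-disjoint q q01 q10

      tame-option : ∀ {w} → M ⊢ x ⟶ w → Tame M w
      tame-option {w} x⟶w = tame w (option-closed {P} closed x w x∈P x⟶w) (⟶⇒≺ M x w x⟶w)

      x⟶y′ : Nonempty q → M ⊢ x ⟶ y
      x⟶y′ q≢[] = move x (here refl) (Nonempty-unshift y i₂ j₂ (subst Nonempty (sym yz≡q) q≢[]))

      x⟶z′ : Nonempty q → M ⊢ x ⟶ z
      x⟶z′ q≢[] = move x (there (here refl)) (Nonempty-unshift z i₁ j₁ (subst Nonempty (sym zy≡q) q≢[]))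

      Small : Pred Partition 0ℓ
      Small w = Is⟨ 0 , 1 ⟩ M w ⊎ Is⟨ 1 , 0 ⟩ M w

      small-or-big : ∀ {w} → M ⊢ x ⟶ w → Small w ⊎ Big w
      small-or-big x⟶w = assocˡ (tame-option x⟶w)

      escape : ∀ {w} → M ⊢ x ⟶ w → ∃[ u ] M ⊢ x ⟶ u × Small u
      escape x⟶y@(_ , _ , here refl , refl , _) = case small-or-big x⟶y of λ where
        (inj₁ small) → _ , x⟶y , small
        (inj₂ y-big) →
          let y-labels = labels x⟶y y-options y-big
              -- The labels of the options of `y` show `q` nonempty, which makes the second move
              -- legal.
              x⟶z = x⟶z′ (proj₁ (proj₂ y-labels))
          in [ (λ small → _ , x⟶z , small)
             , (λ z-big → ⊥-elim (¬consistent y-labels (labels x⟶z z-options z-big))) ]′ (small-or-big x⟶z)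
      escape x⟶z@(_ , _ , there (here refl) , refl , _) = case small-or-big x⟶z of λ where
        (inj₁ small) → _ , x⟶z , small
        (inj₂ z-big) →
          let z-labels = labels x⟶z z-options z-big
              x⟶y = x⟶y′ (proj₁ (proj₂ z-labels))
          in [ (λ small → _ , x⟶y , small)
             , (λ y-big → ⊥-elim (¬consistent (labels x⟶y y-options y-big) z-labels)) ]′ (small-or-big x⟶y)

    two-moves-pet : FamilyHas Pet M P
    two-moves-pet = escapes⇒pet closed escapes

-- A shift can be empty, so the families themselves need not be shift-closed; each is embedded in a
-- class that is.
⊆-pet : ∀ {M P Q} → (∀ μ → P μ → Q μ) → FamilyHas Pet M Q → FamilyHas Pet M P
⊆-pet P⊆Q pet lam lam∈P = pet lam (P⊆Q lam lam∈P)

-- Pawn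

-- Every pawn move removes a column, so a terminal `x[1,2]` has at most one column, and so has
-- `x[2,2]`.
pawn-cornered : TwoMoves.Cornered (nonzero Pawn) U
pawn-cornered x _ _ _ _ q↛ = inj₂ (Grundy.row≤⇒terminal Pawn x 2 2 λ
  { (here refl)         → ≤-trans (row-suc≤ x 1) row₁≤3
  ; (there (here refl)) → ≤-trans (row-suc≤ x 2) (≤-trans (row-suc≤ x 1) row₁≤3) })
  where
  row₁≤3 : row x 1 ≤ 3
  row₁≤3 = Grundy.terminal⇒row≤ Pawn x 1 2 q↛ (here refl)

pawn-pet : FamilyHas Pet Pawn U
pawn-pet = TwoMoves.two-moves-pet (nonzero Pawn) {U} (λ _ _ _ _ → tt) pawn-cornered

-- Knight

-- These are the rectangles and the empty partition.
EqualRows : Pred Partition 0ℓ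
EqualRows μ = ∀ k l → 0 < row μ k → 0 < row μ l → row μ k ≡ row μ l

equalRows-closed : ShiftClosed EqualRows
equalRows-closed μ i j rows≡ k l 0<k 0<l
  rewrite row-shift μ i j k | row-shift μ i j l =
  cong (_∸ j) (rows≡ (i + k) (i + l) (≤-trans 0<k (m∸n≤m _ j)) (≤-trans 0<l (m∸n≤m _ j)))

-- The position x[3,3] has at least two rows and columns, and if it is terminal
-- then it is [2,2].
knight-cornered : TwoMoves.Cornered (nonzero Knight) EqualRows
knight-cornered x rows≡ 4<row₂ 3<row₃ 2<row₄ q↛ = inj₁ (Grundy.row≤⇒terminal Knight x 2 4 λ
  { (here refl)         → ≤-trans row₃≤5 (n≤1+n 5)
  ; (there (here refl)) → row₄≤5 })
  where
  row₄≤5 : row x 4 ≤ 5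
  row₄≤5 = Grundy.terminal⇒row≤ Knight x 3 3 q↛ (here refl)

  row₃≤5 : row x 3 ≤ 5
  row₃≤5 = ≤-trans (≤-reflexive (rows≡ 3 4 (≤-trans (s≤s z≤n) 3<row₃) (≤-trans (s≤s z≤n) 2<row₄))) row₄≤5

nth-replicate : ∀ r c k → 0 < nth (replicate r c) k → nth (replicate r c) k ≡ c
nth-replicate (suc _) _ zero    _ = refl
nth-replicate (suc r) c (suc k) p = nth-replicate r c k p

rectangle⊆equalRows : ∀ μ → Rectangle μ → EqualRows μ
rectangle⊆equalRows _ (r , c , _ , _ , refl) k l 0<k 0<l =
  trans (nth-replicate r c k 0<k) (sym (nth-replicate r c l 0<l))

knight-pet : FamilyHas Pet Knight Rectangle
knight-pet = ⊆-pet rectangle⊆equalRows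
  (TwoMoves.two-moves-pet (nonzero Knight) {EqualRows} equalRows-closed knight-cornered)

-- King

-- Rows of staircases drop by one, so that the moves (0,1) and (1,0) coincide.
UnitSteps : Pred Partition 0ℓ
UnitSteps μ = ∀ k → row μ k ∸ 1 ≡ row μ (suc k)

unitSteps-closed : ShiftClosed UnitSteps
unitSteps-closed μ i j unit k
  rewrite row-shift μ i j k | row-shift μ i j (suc k) | +-suc i k | sym (unit (i + k)) =
  ∸-∸-comm (row μ (i + k)) j 1
  where
  ∸-∸-comm : ∀ a b c → a ∸ b ∸ c ≡ a ∸ c ∸ b
  ∸-∸-comm a b c = trans (∸-+-assoc a b c) (trans (cong (a ∸_) (+-comm b c)) (sym (∸-+-assoc a c b)))

nth-applyDownFrom-suc : ∀ n k → nth (applyDownFrom suc n) k ≡ n ∸ k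
nth-applyDownFrom-suc zero    k       = sym (0∸n≡0 k)
nth-applyDownFrom-suc (suc n) zero    = refl
nth-applyDownFrom-suc (suc n) (suc k) = nth-applyDownFrom-suc n k

staircase⊆unitSteps : ∀ μ → Staircase μ → UnitSteps μ
staircase⊆unitSteps _ (n , _ , refl) k
  rewrite nth-applyDownFrom-suc n k | nth-applyDownFrom-suc n (suc k) =
  trans (∸-+-assoc n k 1) (cong (n ∸_) (+-comm k 1))

-- Removing a column lowers each row by one, which turns it into the next row.
unitSteps⇒[0,1]≡[1,0] : ∀ x → UnitSteps x → x [ 0 , 1 ] ≡ x [ 1 , 0 ]
unitSteps⇒[0,1]≡[1,0] x unit = row-injective _ _ λ k →
  trans (row-shift x 0 1 k) (trans (unit k) (sym (row-shift x 1 0 k)))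

-- If y = x[0,1] is not itself (0,1) or (1,0), it has options of both kinds, and
-- these are y[0,1] = y[1,0] = x[1,1] and y[1,1]; hence x[1,1] is of one of them.
king-escapes : Grundy.Escapes King UnitSteps
king-escapes x unit x⟶ tame = [ (λ small → y , x⟶y , small) , via-d ]′ (assocˡ (tame-below 0 1 x⟶y))
  where
  open Grundy King

  Small : Pred Partition 0ℓ
  Small w = Is⟨ 0 , 1 ⟩ King w ⊎ Is⟨ 1 , 0 ⟩ King w

  y d e : Partition
  y = x [ 0 , 1 ]
  d = x [ 1 , 1 ]
  e = y [ 1 , 1 ]

  x⟶y : King ⊢ x ⟶ y
  x⟶y = move x (here refl) (y≢[] x⟶)
    where
    y≢[] : ∀ {w} → King ⊢ x ⟶ w → Nonempty y
    y≢[] (_ , _ , here refl , refl , ≢[])                 = ≢[]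
    y≢[] (_ , _ , there (here refl) , refl , ≢[])         =
      subst Nonempty (sym (unitSteps⇒[0,1]≡[1,0] x unit)) ≢[]
    y≢[] (_ , _ , there (there (here refl)) , refl , ≢[]) =
      <row⇒Nonempty x 0 1 (≤-trans (Nonempty⇒<row x 1 1 ≢[]) (row-suc≤ x 0))

  y-options : ∀ {w} → King ⊢ y ⟶ w → (w ≡ d ⊎ w ≡ e) × Nonempty w
  y-options (_ , _ , here refl , refl , ≢[])                 =
    inj₁ (trans (unitSteps⇒[0,1]≡[1,0] y (unitSteps-closed x 0 1 unit)) (shift-shift x 0 1 1 0)) , ≢[]
  y-options (_ , _ , there (here refl) , refl , ≢[])         = inj₁ (shift-shift x 0 1 1 0) , ≢[]
  y-options (_ , _ , there (there (here refl)) , refl , ≢[]) = inj₂ refl , ≢[]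

  tame-below : ∀ i j → King ⊢ x ⟶ x [ i , j ] → Tame King (x [ i , j ])
  tame-below i j x⟶w = tame (x [ i , j ]) (unitSteps-closed x i j unit) (⟶⇒≺ King x (x [ i , j ]) x⟶w)

  via-d : (∃[ k ] 2 ≤ k × Is⟨ k , k ⟩ King y) → ∃[ w ] King ⊢ x ⟶ w × Small w
  via-d (_ , 2≤k , y≡k) =
    let (a , y⟶a , a01) , (b , y⟶b , b10) = big-options y 2≤k y≡k λ {w} y⟶w →
          tame w (option-closed {UnitSteps} unitSteps-closed y w (unitSteps-closed x 0 1 unit) y⟶w)
               (<-trans (⟶⇒≺ King y w y⟶w) (⟶⇒≺ King x y x⟶y))
    in choose (y-options y⟶a) a01 (y-options y⟶b) b10
    where
    choose : ∀ {a b} → (a ≡ d ⊎ a ≡ e) × Nonempty a → Is⟨ 0 , 1 ⟩ King a →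
             (b ≡ d ⊎ b ≡ e) × Nonempty b → Is⟨ 1 , 0 ⟩ King b → ∃[ w ] King ⊢ x ⟶ w × Small w
    choose (inj₁ refl , ≢[]) a01 _                   _   = d , move x (there (there (here refl))) ≢[] , inj₁ a01
    choose _                 _   (inj₁ refl , ≢[])   b10 = d , move x (there (there (here refl))) ≢[] , inj₂ b10
    choose (inj₂ refl , _)   a01 (inj₂ refl , _)     b10 = ⊥-elim (01-10-disjoint e a01 b10)

king-pet : FamilyHas Pet King Staircase
king-pet = ⊆-pet staircase⊆unitSteps (Grundy.escapes⇒pet King {UnitSteps} unitSteps-closed king-escapes)

-- Downright

-- The drop from the last nonzero row to 0 is left free, because removing columns shortens it.
EqualSteps : Pred Partition 0ℓ
EqualSteps μ = ∃[ c ] ∀ k → 0 < row μ (suc k) →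
  row μ k ≡ row μ (suc k) ⊎ row μ k ≡ row μ (suc k) + c

equalSteps-closed : ShiftClosed EqualSteps
equalSteps-closed μ i j (c , steps) = c , steps′
  where
  steps′ : ∀ k → 0 < row (μ [ i , j ]) (suc k) →
           row (μ [ i , j ]) k ≡ row (μ [ i , j ]) (suc k) ⊎
           row (μ [ i , j ]) k ≡ row (μ [ i , j ]) (suc k) + c
  steps′ k 0< rewrite row-shift μ i j k | row-shift μ i j (suc k) | +-suc i k =
    -- Subtracting `j` commutes with adding `c` only without truncation; the lower row stays
    -- nonzero, so it is at least `j`.
    Sum.map (cong (_∸ j)) (λ eq → trans (cong (_∸ j) eq) (+-∸-comm c j≤))
            (steps (i + k) (≤-trans 0< (m∸n≤m _ j)))
    where
    j≤ : j ≤ row μ (suc (i + k))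
    j≤ = <⇒≤ (m∸n≢0⇒n<m (n>0⇒n≢0 0<))

-- The final drop to 0 is included here, which lets the induction prepend one block at a time.
StepsBy : ℕ → List ℕ → Set
StepsBy c xs = ∀ k → nth xs k ≡ nth xs (suc k) ⊎ nth xs k ≡ nth xs (suc k) + c

replicate-++-stepsBy : ∀ {a c ys} r → a ≡ nth ys 0 + c → StepsBy c ys → StepsBy c (replicate r a ++ ys)
replicate-++-stepsBy zero          _  steps k       = steps k
replicate-++-stepsBy (suc zero)    a≡ steps zero    = inj₂ a≡
replicate-++-stepsBy (suc zero)    _  steps (suc k) = steps k
replicate-++-stepsBy (suc (suc r)) a≡ steps zero    = inj₁ refl
replicate-++-stepsBy (suc (suc r)) a≡ steps (suc k) = replicate-++-stepsBy (suc r) a≡ steps k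

module _ (r c : ℕ) where

  blocks : ℕ → List ℕ
  blocks k = concatMap (λ m → replicate (suc r) (m * c)) (applyDownFrom suc k)

  -- Repeating each part `suc r` times keeps the first block nonempty.
  blocks-head : ∀ k → nth (blocks k) 0 ≡ k * c
  blocks-head zero    = refl
  blocks-head (suc _) = refl

  blocks-stepsBy : ∀ k → StepsBy c (blocks k)
  blocks-stepsBy zero    _ = inj₁ refl
  blocks-stepsBy (suc k)   = replicate-++-stepsBy (suc r)
    (trans (+-comm c (k * c)) (cong (_+ c) (sym (blocks-head k)))) (blocks-stepsBy k)

generalizedStaircase⊆equalSteps : ∀ μ → GeneralizedStaircase μ → EqualSteps μ
generalizedStaircase⊆equalSteps _ (suc r , c , k , _ , _ , _ , refl) = c , λ n _ → blocks-stepsBy r c k n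

subpartition⊆equalSteps : ∀ μ → NonemptySubpartitionOfGeneralizedStaircase μ → EqualSteps μ
subpartition⊆equalSteps _ (lam , i , j , gs , refl , _) =
  equalSteps-closed lam i j (generalizedStaircase⊆equalSteps lam gs)

-- A terminal x[1,1] means that the second and third rows of x are 2 and 1, so
-- the step is 1 and the first row is at most 3.
downright-cornered : TwoMoves.Cornered (nonzero Downright) EqualSteps
downright-cornered x (c , steps) _ 1<row₁ 0<row₂ q↛ = inj₁ (Grundy.row≤⇒terminal Downright x 0 2 λ
  { (here refl)         → [ (λ eq → ≤-trans (≤-reflexive eq) (≤-trans row₁≤2 (n≤1+n 2)))
                          , (λ eq → ≤-trans (≤-reflexive eq) (+-mono-≤ row₁≤2 c≤1)) ]′
                          (steps 0 (≤-trans (s≤s z≤n) 1<row₁))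
  ; (there (here refl)) → row₁≤2 })
  where
  row₁≤2 : row x 1 ≤ 2
  row₁≤2 = Grundy.terminal⇒row≤ Downright x 1 1 q↛ (here refl)

  row₂≤1 : row x 2 ≤ 1
  row₂≤1 = Grundy.terminal⇒row≤ Downright x 1 1 q↛ (there (here refl))

  c≤1 : c ≤ 1
  c≤1 = [ (λ eq → ⊥-elim (<⇒≱ 1<row₁ (≤-trans (≤-reflexive eq) row₂≤1)))
        , (λ eq → +-cancelˡ-≤ 1 c 1 (≤-trans (+-monoˡ-≤ c 0<row₂) (≤-trans (≤-reflexive (sym eq)) row₁≤2))) ]′
        (steps 1 0<row₂)

downright-pet : FamilyHas Pet Downright NonemptySubpartitionOfGeneralizedStaircase
downright-pet = ⊆-pet subpartition⊆equalSteps
  (TwoMoves.two-moves-pet (nonzero Downright) {EqualSteps}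
    equalSteps-closed downright-cornered)

-- Games that are not forced

partition : (xs : List ℕ) →
            {True (Linked.linked? _≥?_ xs)} → {True (All.all? (0 <?_) xs)} → Partition
partition xs {xs↘} {xs⁺} = mkPartition xs (toWitness xs↘) (toWitness xs⁺)

[4,3,2,1] [4⁷] [4,2] : Partition
[4,3,2,1] = partition (4 ∷ 3 ∷ 2 ∷ 1 ∷ [])
[4⁷]      = partition (replicate 7 4)
[4,2]     = partition (4 ∷ 2 ∷ [])

-- The options are [3,2,1], labelled (2,2), and [2,1], labelled (1,0). The depth 4 suffices as plays
-- have at most three moves.
pawn-¬forced : ¬ Forced Pawn [4,3,2,1]
pawn-¬forced = 01-with-big-option⇒¬forced {y = y}
  (unroll-value 0 4 x , unroll-value 1 4 x) (move x (here refl) λ ()) (unroll-value 0 3 y)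
  where
  open Grundy Pawn
  x y : Partition
  x = [4,3,2,1]
  y = x [ 0 , 1 ]

-- The options are five rows of 3, labelled (2,2), and six rows of 2, labelled (1,0).
knight-¬forced : ¬ Forced Knight [4⁷]
knight-¬forced = 01-with-big-option⇒¬forced {y = y}
  (unroll-value 0 4 x , unroll-value 1 4 x) (move x (there (here refl)) λ ()) (unroll-value 0 3 y)
  where
  open Grundy Knight
  x y : Partition
  x = [4⁷]
  y = x [ 2 , 1 ]

-- On staircases King lowers the number of rows by 1 or 2; from one row up the Sprague-Grundy values
-- are 0, 1, 2, 0.
king-¬forced : ¬ Forced King [4,3,2,1]
king-¬forced = 01-with-big-option⇒¬forced {y = y}
  (unroll-value 0 4 x , unroll-value 1 4 x) (move x (here refl) λ ()) (unroll-value 0 3 y)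
  where
  open Grundy King
  x y : Partition
  x = [4,3,2,1]
  y = x [ 0 , 1 ]

-- The options are [3,1], labelled (2,2), and [2], labelled (1,0).
downright-¬forced : ¬ Forced Downright [4,2]
downright-¬forced = 01-with-big-option⇒¬forced {y = y}
  (unroll-value 0 5 x , unroll-value 1 5 x) (move x (here refl) λ ()) (unroll-value 0 4 y)
  where
  open Grundy Downright
  x y : Partition
  x = [4,2]
  y = x [ 0 , 1 ]

-- Assembly of the five families

pet∧¬forced : ∀ {M P lam} → FamilyHas Pet M P → P lam → ¬ Forced M lam → PetReturnableNotForced M P
pet∧¬forced {M} {P} pet lam∈P ¬forced = pet , Grundy.pet⇒returnable M {P} pet , _ , lam∈P , ¬forced

theorem4p9 :
    PetReturnableNotForced Pawn Nonempty ×
    PetReturnableNotForced Knight Rectangle ×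
    PetReturnableNotForced King Staircase ×
    PetReturnableNotForced Pawn Staircase ×
    PetReturnableNotForced Downright NonemptySubpartitionOfGeneralizedStaircase
theorem4p9 =
  pet∧¬forced {lam = [4,3,2,1]} (⊆-pet (λ _ _ → tt) pawn-pet) (λ ()) pawn-¬forced ,
  pet∧¬forced {lam = [4⁷]} knight-pet (7 , 4 , s≤s z≤n , s≤s z≤n , refl) knight-¬forced ,
  pet∧¬forced {lam = [4,3,2,1]} king-pet [4,3,2,1]-staircase king-¬forced ,
  pet∧¬forced {lam = [4,3,2,1]} (⊆-pet (λ _ _ → tt) pawn-pet) [4,3,2,1]-staircase pawn-¬forced ,
  -- The partition [4,2] is the generalized staircase with r = 1 and c = k = 2, shifted by (0,0).
  pet∧¬forced {lam = [4,2]} downright-pet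
    ([4,2] , 0 , 0 , (1 , 2 , 2 , s≤s z≤n , s≤s z≤n , s≤s z≤n , refl) , refl , λ ()) downright-¬forced
  where
  [4,3,2,1]-staircase : Staircase [4,3,2,1]
  [4,3,2,1]-staircase = 4 , s≤s z≤n , refl
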